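{- For each integer $k\geq 3$, there exists a simple connected $k$-regular graph $X$ with no separating transitions such that the line graph $L(X)$ has no Hamilton decomposition.
   Context: A transition at a vertex $u$ of a graph $X$ is a pair of half-edges incident with $u$. If $t$ is a transition at $u$, then $X^t$ denotes the graph obtained from $X$ by splitting $u$ into two new vertices $u_1$ and $u_2$, joining the two half-edges of $t$ to $u_1$, and joining every other half-edge at $u$ to $u_2$. A transition $t$ is separating if $X^t$ has more connected components than $X$. If a graph is regular of degree $2m$ or $2m+1$, a Hamilton decomposition of it is a set of $m$ pairwise edge-disjoint Hamilton cycles. The line graph $L(X)$ has the edges of $X$ as vertices, two being adjacent when they share an endpoint in $X$. -}

module Defs where

open import Level using (Level; 0ℓ) renaming (suc to lsuc)
open import Data.Nat using (ℕ; zero; suc; _+_; _*_; _≤_; _<_)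
open import Data.Nat.DivMod using (_%_; m%n<n)
open import Data.Fin using (Fin; toℕ; fromℕ<)
import Data.Fin as F
open import Data.Bool using (Bool; true; false)
open import Data.Unit using (⊤; tt)
open import Data.Empty using (⊥)
open import Data.Sum using (_⊎_; inj₁; inj₂)
open import Data.Product using (Σ; ∃; _×_; _,_; proj₁; proj₂)
open import Data.List using (List; length)
open import Data.List.Membership.Propositional using (_∈_)
open import Data.List.Relation.Unary.Unique.Propositional using (Unique)
open import Relation.Nullary using (¬_)
open import Relation.Binary.PropositionalEquality using (_≡_; _≢_)
open import Relation.Binary.Construct.Closure.ReflexiveTransitive using (Star)
open import Function.Bundles using (_⇔_)

record Graph : Set₁ where
  field
    V   : Set
    Adj : V → V → Set
open Graph public

Reachable : (G : Graph) → V G → V G → Set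
Reachable G = Star (Adj G)

Connected : Graph → Set
Connected G = V G × (∀ x y → Reachable G x y)

Regular : Graph → ℕ → Set
Regular G d = ∀ v → Σ (List (V G)) λ ns →
  Unique ns × (∀ w → (w ∈ ns) ⇔ Adj G v w) × length ns ≡ d

next : ∀ {m} → Fin m → Fin m
next {suc m} i = fromℕ< (m%n<n (suc (toℕ i)) (suc m))

record HamiltonCycle (G : Graph) : Set where
  field
    len     : ℕ
    len≥3   : 3 ≤ len
    c       : Fin len → V G
    inj     : ∀ i j → c i ≡ c j → i ≡ j
    surj    : ∀ v → ∃ λ i → c i ≡ v
    adj     : ∀ i → Adj G (c i) (c (next i))
open HamiltonCycle public

CycleEdge : {G : Graph} → HamiltonCycle G → V G → V G → Set
CycleEdge H x y = ∃ λ i →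
  (c H i ≡ x × c H (next i) ≡ y) ⊎ (c H i ≡ y × c H (next i) ≡ x)

EdgeDisjoint : {G : Graph} → HamiltonCycle G → HamiltonCycle G → Set
EdgeDisjoint {G} H₁ H₂ = ∀ x y → CycleEdge H₁ x y → ¬ CycleEdge H₂ x y

HamiltonDecomposition : Graph → Set
HamiltonDecomposition G = Σ ℕ λ m →
  (Regular G (2 * m) ⊎ Regular G (suc (2 * m))) ×
  Σ (Fin m → HamiltonCycle G) λ H →
    ∀ i j → i ≢ j → EdgeDisjoint (H i) (H j)

record SimpleGraph (n : ℕ) : Set where
  field
    adj   : Fin n → Fin n → Bool
    sym   : ∀ i j → adj i j ≡ adj j i
    irref : ∀ i → adj i i ≡ false
open SimpleGraph public

toGraph : ∀ {n} → SimpleGraph n → Graph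
toGraph {n} X = record { V = Fin n ; Adj = λ i j → adj X i j ≡ true }

LEdge : ∀ {n} → SimpleGraph n → Set
LEdge {n} X = Σ (Fin n × Fin n) λ p → (proj₁ p F.< proj₂ p) × (adj X (proj₁ p) (proj₂ p) ≡ true)

ShareEnd : ∀ {n} {X : SimpleGraph n} → LEdge X → LEdge X → Set
ShareEnd ((a , b) , _) ((c′ , d) , _) = a ≡ c′ ⊎ a ≡ d ⊎ b ≡ c′ ⊎ b ≡ d

LineGraph : ∀ {n} → SimpleGraph n → Graph
LineGraph X = record
  { V   = LEdge X
  ; Adj = λ e f → proj₁ e ≢ proj₁ f × ShareEnd {X = X} e f }

-- Transitions.  In a simple graph the half-edges at u correspond to the
-- neighbours of u, so a transition at u is a pair of distinct
-- neighbours a , b of u.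

record Transition {n} (X : SimpleGraph n) (u : Fin n) : Set where
  field
    a b  : Fin n
    a≢b  : a ≢ b
    adja : adj X u a ≡ true
    adjb : adj X u b ≡ true

-- X^t: vertex inj₁ u plays the role of u₁ (carrying the half-edges ua, ub),
-- the new vertex inj₂ tt is u₂ (carrying all other half-edges at u);
-- every other vertex inj₁ x is unchanged.
splitAdj : ∀ {n} (X : SimpleGraph n) (u a b : Fin n) →
           Fin n ⊎ ⊤ → Fin n ⊎ ⊤ → Set
splitAdj X u a b (inj₁ x) (inj₁ y) =
  (adj X x y ≡ true) × (x ≡ u → y ≡ a ⊎ y ≡ b) × (y ≡ u → x ≡ a ⊎ x ≡ b)
splitAdj X u a b (inj₁ x) (inj₂ _) =
  x ≢ u × adj X u x ≡ true × x ≢ a × x ≢ b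
splitAdj X u a b (inj₂ _) (inj₁ y) =
  y ≢ u × adj X u y ≡ true × y ≢ a × y ≢ b
splitAdj X u a b (inj₂ _) (inj₂ _) = ⊥

Split : ∀ {n} (X : SimpleGraph n) (u : Fin n) → Transition X u → Graph
Split {n} X u t = record
  { V = Fin n ⊎ ⊤
  ; Adj = splitAdj X u (Transition.a t) (Transition.b t) }

proj : ∀ {n} (u : Fin n) → Fin n ⊎ ⊤ → Fin n
proj u (inj₁ x) = x
proj u (inj₂ _) = u

-- t is separating iff X^t has more components than X.  Since the
-- projection X^t → X is a surjective graph homomorphism, this holds iff
-- some two vertices of X^t lie in different components of X^t while
-- their images lie in the same component of X.
Separating : ∀ {n} (X : SimpleGraph n) (u : Fin n) → Transition X u → Set
Separating X u t = Σ (V (Split X u t)) λ p → Σ (V (Split X u t)) λ q →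
  Reachable (toGraph X) (proj u p) (proj u q) × ¬ Reachable (Split X u t) p q

NoSeparatingTransitions : ∀ {n} → SimpleGraph n → Set
NoSeparatingTransitions {n} X = ∀ (u : Fin n) (t : Transition X u) → ¬ Separating X u t

{-# OPTIONS --safe #-}

-- Take 2k nodes v_i, w_i (i ∈ ℤ/k) in cyclic order v_0, w_0, v_1, w_1, …, with 2 parallel edges from
-- v_i to w_i and k − 2 parallel edges from w_i to v_{i+1}, and insert into each of these edges a blob:
-- a complete graph on k + 1 vertices with one edge removed, attached by the two ends of that edge.
-- The resulting k-regular graph is 2-connected, hence has no separating transitions.
--
-- A Hamilton decomposition of its line graph consists of k − 1 cycles that use every edge. For each i,
-- the two edges at w_i on the side of v_i are adjacent in the line graph, so some cycle H joins them.
-- Blobs are attached by 2-edge cuts, so the other H-neighbour of each of the two lies inside its blob: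
-- H does not cross from one side of w_i to the other. There are k indices i and only k − 1 cycles, so
-- one cycle turns back at two nodes w_i and w_j, and cannot connect the two arcs between them.

module Submission where

open import Defs
open import Axiom.UniquenessOfIdentityProofs using (module Decidable⇒UIP)
open import Level using (Level)
open import Data.Bool using (Bool; true; false; _∧_)
open import Data.Bool.Properties using (∧-zeroʳ) renaming (_≟_ to _≟ᵇ_)
open import Data.Empty using (⊥)
open import Data.Fin using (Fin; zero; suc; toℕ; fromℕ; inject₁; punchIn; punchOut; remQuot; combine)
import Data.Fin as F
open import Data.Fin.Induction using (<-weakInduction)
open import Data.Fin.Patterns using (0F; 1F; 2F)
open import Data.Fin.Properties as Fin using (_≟_; any?)
open import Data.Fin.Relation.Unary.Top using (view; ‵fromℕ; ‵inject₁)
open import Data.List using (List; length; lookup; tabulate)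
open import Data.List.Membership.Propositional using () renaming (_∈_ to _∈ˡⁱˢᵗ_)
open import Data.List.Membership.Propositional.Properties using (∈-tabulate⁺; ∈-tabulate⁻; ∈-lookup)
open import Data.List.Properties using (length-tabulate)
open import Data.List.Relation.Unary.All using () renaming (lookup to All-lookup)
open import Data.List.Relation.Unary.AllPairs using (_∷_)
open import Data.List.Relation.Unary.Any using (index)
open import Data.List.Relation.Unary.Any.Properties using (lookup-index)
open import Data.List.Relation.Unary.Unique.Propositional using (Unique)
open import Data.List.Relation.Unary.Unique.Propositional.Properties using (tabulate⁺)
open import Data.Nat using (ℕ; suc; _+_; _*_; _≤_; _<_; z≤n; s≤s; _<?_)
open import Data.Nat.DivMod using (_%_; n%n≡0; m<n⇒m%n≡m)
import Data.Nat.Properties as ℕ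
open import Data.Product using (Σ; ∃; _×_; _,_; proj₁; proj₂; uncurry)
open import Data.Product.Function.NonDependent.Propositional using (_×-↔_)
import Data.Product.Properties as Product
open import Data.Sum using (_⊎_; inj₁; inj₂)
open import Data.Sum.Function.Propositional using (_⊎-↔_)
import Data.Sum.Properties as Sum
open import Data.Unit using (tt)
open import Function using (_∘_)
open import Function.Bundles using (_⇔_; mk⇔; _↔_; Equivalence; Inverse)
open import Function.Properties.Inverse using (↔-refl; ↔-trans)
open import Relation.Binary using (Rel; IsEquivalence; Symmetric; DecidableEquality; tri<; tri≈; tri>)
open import Relation.Binary.Construct.Closure.ReflexiveTransitive using (Star; ε; _◅_; _◅◅_; gmap; reverse)
open import Relation.Binary.PropositionalEquality as ≡ using (_≡_; _≢_; refl; trans; cong; cong₂; subst; subst₂)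
open import Relation.Nullary using (¬_; Dec; yes; no; does; contradiction)
open import Relation.Nullary.Decidable using (dec-true; dec-false; does-⇔; _×-dec_)

open Decidable⇒UIP _≟ᵇ_ using (≡-irrelevant)
open Equivalence using (to; from)

private
  variable
    ℓ : Level
    n d d′ : ℕ

-- Cyclic successor and predecessor, and walks around a cycle.

prev : Fin n → Fin n
prev {suc n} zero    = fromℕ n
prev {suc n} (suc i) = inject₁ i

next-fromℕ : next (fromℕ n) ≡ zero
next-fromℕ {n} = Fin.toℕ-injective (trans (Fin.toℕ-fromℕ< _)
  (trans (cong (λ t → suc t % suc n) (Fin.toℕ-fromℕ n)) (n%n≡0 (suc n))))

next-inject₁ : (i : Fin n) → next (inject₁ i) ≡ suc i
next-inject₁ {n} i = Fin.toℕ-injective (trans (Fin.toℕ-fromℕ< _)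
  (trans (cong (λ t → suc t % suc n) (Fin.toℕ-inject₁ i)) (m<n⇒m%n≡m (s≤s (Fin.toℕ<n i)))))

next-prev : (i : Fin n) → next (prev i) ≡ i
next-prev zero    = next-fromℕ
next-prev (suc i) = next-inject₁ i

prev-next : (i : Fin n) → prev (next i) ≡ i
prev-next {suc n} i with view i
... | ‵fromℕ      = cong prev next-fromℕ
... | ‵inject₁ i′ = cong prev (next-inject₁ i′)

-- Two steps forward return to the start only on cycles of length at most 2. Hence the two
-- neighbours of a vertex on a Hamilton cycle differ.
next≢prev : 3 ≤ n → (i : Fin n) → next i ≢ prev i
next≢prev (s≤s (s≤s (s≤s z≤n))) zero ()
next≢prev (s≤s (s≤s (s≤s z≤n))) (suc j) eq with view j
... | ‵fromℕ with () ← trans (≡.sym next-fromℕ) eq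
... | ‵inject₁ i = ℕ.m≢1+n+m (toℕ i) {1} (trans
  (≡.sym (trans (Fin.toℕ-inject₁ (inject₁ i)) (Fin.toℕ-inject₁ i)))
  (cong toℕ (trans (≡.sym eq) (next-inject₁ (suc i)))))

-- The missing link is the one entering `m`, so a walk forward from `m` reaches every position
-- before needing it.
cycle-minus-link-connected : {R : Rel (Fin n) ℓ} → IsEquivalence R → (m : Fin n) →
                             (∀ i → i ≢ m → R (prev i) i) → ∀ i j → R i j
cycle-minus-link-connected {n = suc n} {R = R} isEq m link i j = E.trans (E.sym (hub i)) (hub j)
  where
  module E = IsEquivalence isEq
  above : ∀ i → m F.≤ i → R m i
  above = <-weakInduction (λ i → m F.≤ i → R m i)
    (λ m≤0 → E.reflexive (Fin.≤-antisym m≤0 z≤n)) step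
    where
    step : ∀ i → (m F.≤ inject₁ i → R m (inject₁ i)) → m F.≤ suc i → R m (suc i)
    step i ih m≤1+i with suc i ≟ m
    ... | yes refl = E.refl
    ... | no 1+i≢m = E.trans (ih (ℕ.≤-trans m≤i (ℕ.≤-reflexive (≡.sym (Fin.toℕ-inject₁ i))))) (link (suc i) 1+i≢m)
      where
      m≤i : toℕ m ≤ toℕ i
      m≤i = ℕ.≤-pred (ℕ.≤∧≢⇒< m≤1+i (1+i≢m ∘ ≡.sym ∘ Fin.toℕ-injective))
  below : ∀ i → i F.< m → R m i
  below = <-weakInduction (λ i → i F.< m → R m i)
    -- The walk wraps around here: `prev zero` is `fromℕ n`, already reached by `above`.
    (λ 0<m → E.trans (above (fromℕ n) (Fin.≤fromℕ m)) (link zero (Fin.<⇒≢ 0<m)))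
    (λ i ih 1+i<m → E.trans (ih (ℕ.≤-trans (s≤s (ℕ.≤-reflexive (Fin.toℕ-inject₁ i))) (ℕ.<⇒≤ 1+i<m)))
                            (link (suc i) (Fin.<⇒≢ 1+i<m)))
  hub : ∀ i → R m i
  hub i with ℕ.≤-<-connex (toℕ m) (toℕ i)
  ... | inj₁ m≤i = above i m≤i
  ... | inj₂ i<m = below i i<m

-- If `y` were missed, punching it out would inject `Fin (suc n)` into `Fin n`.
injective⇒surjective : (f : Fin n → Fin n) → (∀ i j → f i ≡ f j → i ≡ j) → ∀ y → ∃ λ i → f i ≡ y
injective⇒surjective {suc n} f f-inj y with any? (λ i → f i ≟ y)
... | yes hit = hit
... | no ¬hit = contradiction (Fin.injective⇒≤ {f = g} λ {i} {j} eq →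
  f-inj i j (Fin.punchOut-injective (miss i) (miss j) eq)) ℕ.1+n≰n
  where
  miss : ∀ i → y ≢ f i
  miss i eq = ¬hit (i , ≡.sym eq)
  g : Fin (suc n) → Fin n
  g i = punchOut (miss i)

-- Neighbour lists as injective enumerations; degrees.

record Neighbourhood (G : Graph) (v : V G) (d : ℕ) : Set where
  field
    nbr       : Fin d → V G
    injective : ∀ i j → nbr i ≡ nbr j → i ≡ j
    sound     : ∀ i → Adj G v (nbr i)
    complete  : ∀ {w} → Adj G v w → ∃ λ i → nbr i ≡ w
open Neighbourhood

Unique⇒lookup-injective : {A : Set} {xs : List A} → Unique xs →
                          ∀ i j → lookup xs i ≡ lookup xs j → i ≡ j
Unique⇒lookup-injective (x∉ ∷ u) zero    zero    eq = refl
Unique⇒lookup-injective (x∉ ∷ u) zero    (suc j) eq = contradiction eq (All-lookup x∉ (∈-lookup j))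
Unique⇒lookup-injective (x∉ ∷ u) (suc i) zero    eq = contradiction (≡.sym eq) (All-lookup x∉ (∈-lookup i))
Unique⇒lookup-injective (x∉ ∷ u) (suc i) (suc j) eq = cong suc (Unique⇒lookup-injective u i j eq)

module _ {G : Graph} {v : V G} where

  Neighbourhood⇒list : Neighbourhood G v d → Σ (List (V G)) λ ns →
                       Unique ns × (∀ w → (w ∈ˡⁱˢᵗ ns) ⇔ Adj G v w) × length ns ≡ d
  Neighbourhood⇒list N = tabulate (nbr N) , tabulate⁺ (injective N _ _) , mem , length-tabulate (nbr N)
    where
    mem : ∀ w → (w ∈ˡⁱˢᵗ tabulate (nbr N)) ⇔ Adj G v w
    mem w = mk⇔ (λ w∈ → let i , eq = ∈-tabulate⁻ w∈ in subst (Adj G v) (≡.sym eq) (sound N i))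
                (λ a → let i , eq = complete N a in subst (_∈ˡⁱˢᵗ _) eq (∈-tabulate⁺ i))

  list⇒Neighbourhood : (Σ (List (V G)) λ ns →
                       Unique ns × (∀ w → (w ∈ˡⁱˢᵗ ns) ⇔ Adj G v w) × length ns ≡ d) → Neighbourhood G v d
  list⇒Neighbourhood (ns , unique , mem , refl) = record
    { nbr       = lookup ns
    ; injective = Unique⇒lookup-injective unique
    ; sound     = λ i → to (mem _) (∈-lookup i)
    ; complete  = λ {w} a → let w∈ = from (mem w) a in index w∈ , ≡.sym (lookup-index w∈)
    }

  degree-≤ : Neighbourhood G v d → Neighbourhood G v d′ → d ≤ d′
  degree-≤ N N′ = Fin.injective⇒≤ λ {i} {j} eq → injective N i j
    (trans (≡.sym (proj₂ (pos i))) (trans (cong (nbr N′) eq) (proj₂ (pos j))))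
    where
    pos : ∀ i → ∃ λ i′ → nbr N′ i′ ≡ nbr N i
    pos i = complete N′ (sound N i)

  degree-unique : Neighbourhood G v d → Neighbourhood G v d′ → d ≡ d′
  degree-unique N N′ = ℕ.≤-antisym (degree-≤ N N′) (degree-≤ N′ N)

-- Adjacency and connectedness along Hamilton cycles.

module _ {G : Graph} (H : HamiltonCycle G) where

  CycleEdge-sym : ∀ {x y} → CycleEdge H x y → CycleEdge H y x
  CycleEdge-sym (i , inj₁ p) = i , inj₂ p
  CycleEdge-sym (i , inj₂ p) = i , inj₁ p

  next-edge : ∀ i → CycleEdge H (c H i) (c H (next i))
  next-edge i = i , inj₁ (refl , refl)

  prev-edge : ∀ i → CycleEdge H (c H i) (c H (prev i))
  prev-edge i = prev i , inj₂ (refl , cong (c H) (next-prev i))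

  cycle-neighbours : ∀ i {y} → CycleEdge H (c H i) y → y ≡ c H (next i) ⊎ y ≡ c H (prev i)
  cycle-neighbours i (j , inj₁ (cj≡ci , eq)) with refl ← inj H j i cj≡ci = inj₁ (≡.sym eq)
  cycle-neighbours i (j , inj₂ (eq , cj≡ci)) with refl ← inj H (next j) i cj≡ci =
    inj₂ (trans (≡.sym eq) (cong (c H) (≡.sym (prev-next j))))

  -- On the cycle `x` has only a successor and a predecessor, and `y` and `y′` take up both.
  at-most-two : ∀ {x y y′ z} → CycleEdge H x y → CycleEdge H x y′ → y ≢ y′ → CycleEdge H x z → z ≡ y ⊎ z ≡ y′
  at-most-two {x} xy xy′ y≢y′ xz with i , refl ← surj H x
    with cycle-neighbours i xy | cycle-neighbours i xy′ | cycle-neighbours i xz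
  ... | inj₁ p | inj₁ q | _ = contradiction (trans p (≡.sym q)) y≢y′
  ... | inj₂ p | inj₂ q | _ = contradiction (trans p (≡.sym q)) y≢y′
  ... | inj₁ p | inj₂ q | inj₁ r = inj₁ (trans r (≡.sym p))
  ... | inj₁ p | inj₂ q | inj₂ r = inj₂ (trans r (≡.sym q))
  ... | inj₂ p | inj₁ q | inj₁ r = inj₂ (trans r (≡.sym q))
  ... | inj₂ p | inj₁ q | inj₂ r = inj₁ (trans r (≡.sym p))

  closed⇒constant : (S : V G → Bool) → (∀ x y → CycleEdge H x y → S x ≡ S y) → ∀ x y → S x ≡ S y
  closed⇒constant S link x y with i , refl ← surj H x | j , refl ← surj H y =
    cycle-minus-link-connected {R = λ i j → S (c H i) ≡ S (c H j)}
      (record { refl = refl ; sym = ≡.sym ; trans = trans }) i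
      (λ i _ → ≡.sym (link _ _ (prev-edge i))) i j

  -- A cycle minus the vertex z is connected; S′ extends S over the gap, so that only one link is lost.
  closed-off-vertex⇒constant : (S : V G → Bool) (z : V G) →
    (∀ x y → CycleEdge H x y → x ≢ z → y ≢ z → S x ≡ S y) →
    ∀ x y → x ≢ z → y ≢ z → S x ≡ S y
  closed-off-vertex⇒constant S z link x y x≢z y≢z
    with m , refl ← surj H z | i , refl ← surj H x | j , refl ← surj H y =
    trans (≡.sym (S′-off i (x≢z ∘ cong (c H))))
      (trans (cycle-minus-link-connected {R = λ i j → S′ i ≡ S′ j}
               (record { refl = refl ; sym = ≡.sym ; trans = trans }) m S′-link i j)
             (S′-off j (y≢z ∘ cong (c H))))
    where
    S′ : Fin (len H) → Bool
    S′ i with i ≟ m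
    ... | yes _ = S (c H (next m))
    ... | no _  = S (c H i)
    S′-off : ∀ i → i ≢ m → S′ i ≡ S (c H i)
    S′-off i i≢m with i ≟ m
    ... | yes i≡m = contradiction i≡m i≢m
    ... | no _    = refl
    S′-link : ∀ i → i ≢ m → S′ (prev i) ≡ S′ i
    S′-link i i≢m rewrite S′-off i i≢m with prev i ≟ m
    ... | yes refl = cong (S ∘ c H) (next-prev i)
    ... | no p≢m   = link _ _ (CycleEdge-sym (prev-edge i)) (p≢m ∘ inj H _ _) (i≢m ∘ inj H _ _)

  -- Cycle edges are symmetric, so passing `P` on in one direction already makes its truth value
  -- constant along edges.
  closed-off-vertex : {P : V G → Set} → (∀ x → Dec (P x)) → (z : V G) →
    (∀ x y → CycleEdge H x y → x ≢ z → y ≢ z → P x → P y) →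
    ∀ x y → x ≢ z → y ≢ z → P x → P y
  closed-off-vertex P? z link x y x≢z y≢z px
    with P? y | closed-off-vertex⇒constant (does ∘ P?) z
      (λ x y xy x≢z y≢z → does-⇔ (mk⇔ (link x y xy x≢z y≢z) (link y x (CycleEdge-sym xy) y≢z x≢z)) (P? x) (P? y))
      x y x≢z y≢z
  ... | yes py | _ = py
  ... | no _   | eq with () ← trans (≡.sym (dec-true (P? x) px)) eq

-- The m pairwise edge-disjoint cycles use 2m distinct neighbours of each vertex.
cycles-cover : {G : Graph} → Symmetric (Adj G) → {m : ℕ} (H : Fin m → HamiltonCycle G) →
               (∀ i j → i ≢ j → EdgeDisjoint (H i) (H j)) →
               ∀ {x y} → Neighbourhood G x (2 * m) → Adj G x y → ∃ λ h → CycleEdge (H h) x y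
cycles-cover {G} G-sym {m} H disjoint {x} {y} N xy =
  let i , i≡y    = complete N xy
      j , pos-j≡i = injective⇒surjective (proj₁ ∘ pos) pos-injective i
  in  _ , subst (CycleEdge (H (proj₂ (remQuot {2} m j))) x)
            (trans (≡.sym (proj₂ (pos j))) (trans (cong (nbr N) pos-j≡i) i≡y)) (edge (remQuot {2} m j))
  where
  at : ∀ h → ∃ λ i → c (H h) i ≡ x
  at h = surj (H h) x
  step : ∀ {n} → Fin 2 → Fin n → Fin n
  step 0F = next
  step 1F = prev
  g : Fin 2 × Fin m → V G
  g (s , h) = c (H h) (step s (proj₁ (at h)))
  edge : ∀ p → CycleEdge (H (proj₂ p)) x (g p)
  edge (0F , h) with i , refl ← at h = next-edge (H h) i
  edge (1F , h) with i , refl ← at h = prev-edge (H h) i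
  g-injective : ∀ p q → g p ≡ g q → p ≡ q
  g-injective (s , h) (s′ , h′) eq with h ≟ h′
  ... | no h≢h′ = contradiction (subst (CycleEdge (H h′) x) (≡.sym eq) (edge (s′ , h′)))
                                (disjoint h h′ h≢h′ _ _ (edge (s , h)))
  g-injective (0F , h) (0F , h) eq | yes refl = refl
  g-injective (1F , h) (1F , h) eq | yes refl = refl
  g-injective (0F , h) (1F , h) eq | yes refl = contradiction (inj (H h) _ _ eq) (next≢prev (len≥3 (H h)) _)
  g-injective (1F , h) (0F , h) eq | yes refl = contradiction (≡.sym (inj (H h) _ _ eq)) (next≢prev (len≥3 (H h)) _)
  cycle-adj : ∀ h {y} → CycleEdge (H h) x y → Adj G x y
  cycle-adj h (i , inj₁ (refl , refl)) = adj (H h) i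
  cycle-adj h (i , inj₂ (refl , refl)) = G-sym (adj (H h) i)
  pos : ∀ j → ∃ λ i → nbr N i ≡ g (remQuot {2} m j)
  pos j = complete N (cycle-adj _ (edge (remQuot {2} m j)))
  pos-injective : ∀ i j → proj₁ (pos i) ≡ proj₁ (pos j) → i ≡ j
  pos-injective i j eq = trans (≡.sym (Fin.combine-remQuot {2} m i))
    (trans (cong (uncurry combine) (g-injective (remQuot {2} m i) (remQuot {2} m j)
             (trans (≡.sym (proj₂ (pos i))) (trans (cong (nbr N) eq) (proj₂ (pos j))))))
           (Fin.combine-remQuot {2} m j))

-- Two-connectedness and separating transitions.

pattern star = inj₂ tt

-- Supplies, at a vertex of degree at least 3, a neighbour outside a given transition.
third : (i j : Fin (3 + n)) → ∃ λ l → l ≢ i × l ≢ j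
third 0F            0F            = 1F , (λ ()) , λ ()
third 0F            1F            = 2F , (λ ()) , λ ()
third 0F            (suc (suc _)) = 1F , (λ ()) , λ ()
third 1F            0F            = 2F , (λ ()) , λ ()
third 1F            (suc _)       = 0F , (λ ()) , λ ()
third (suc (suc _)) 0F            = 1F , (λ ()) , λ ()
third (suc (suc _)) (suc _)       = 0F , (λ ()) , λ ()

module _ (X : SimpleGraph n) where

  adj⇒≢ : ∀ {x y} → adj X x y ≡ true → x ≢ y
  adj⇒≢ {x} xy refl with () ← trans (≡.sym xy) (irref X x)

  adj-sym : Symmetric (Adj (toGraph X))
  adj-sym {x} {y} xy = trans (≡.sym (SimpleGraph.sym X x y)) xy

  AdjOff : Fin n → Fin n → Fin n → Set
  AdjOff u x y = adj X x y ≡ true × x ≢ u × y ≢ u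

  TwoConnected : Set
  TwoConnected = ∀ u x y → x ≢ u → y ≢ u → Star (AdjOff u) x y

  -- Either the first neighbour of `x` is `y`, or deleting that neighbour leaves `x` and `y`
  -- connected.
  twoConnected⇒reachable : Regular (toGraph X) (2 + d) → TwoConnected → ∀ x y → Reachable (toGraph X) x y
  twoConnected⇒reachable regular conn x y = go (nbr N 0F ≟ y)
    where
    N = list⇒Neighbourhood {G = toGraph X} (regular x)
    x≢ : ∀ i → x ≢ nbr N i
    x≢ i = adj⇒≢ (sound N i)
    go : Dec (nbr N 0F ≡ y) → Reachable (toGraph X) x y
    go (yes refl) = sound N 0F ◅ ε
    go (no ≢y)    = gmap _ proj₁ (conn (nbr N 0F) x y (x≢ 0F) (≢y ∘ ≡.sym))

  -- The connected graph `X` minus `u` survives in the split graph. One half of `u` is attached to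
  -- it through `a`, the other through a third neighbour of `u`.
  twoConnected⇒noSeparating : Regular (toGraph X) (3 + d) → TwoConnected → NoSeparatingTransitions X
  twoConnected⇒noSeparating {d} regular conn u t (p , q , _ , ¬pq) = ¬pq (hub p ◅◅ reverse split-sym (hub q))
    where
    open Transition t
    N = list⇒Neighbourhood {G = toGraph X} (regular u)
    T = Split X u t
    split-sym : Symmetric (Adj T)
    split-sym {inj₁ x} {inj₁ y} (xy , f , g) = adj-sym xy , g , f
    split-sym {inj₁ x} {star} e = e
    split-sym {star} {inj₁ x} e = e
    off : ∀ {x y} → x ≢ u → y ≢ u → Reachable T (inj₁ x) (inj₁ y)
    off x≢u y≢u = gmap inj₁ (λ (xy , x≢u , y≢u) → xy , (λ x≡u → contradiction x≡u x≢u) , λ y≡u → contradiction y≡u y≢u)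
                       (conn u _ _ x≢u y≢u)
    a≢u : a ≢ u
    a≢u = adj⇒≢ (adj-sym adja)
    other : ∃ λ w → adj X u w ≡ true × w ≢ a × w ≢ b
    other =
      let i , i≡a = complete N adja
          j , j≡b = complete N adjb
          l , l≢i , l≢j = third i j
      in nbr N l , sound N l , (λ eq → l≢i (injective N l i (trans eq (≡.sym i≡a))))
                             , (λ eq → l≢j (injective N l j (trans eq (≡.sym j≡b))))
    hub : ∀ p → Reachable T p (inj₁ a)
    hub (inj₁ x) with x ≟ u
    ... | yes refl = (adja , (λ _ → inj₁ refl) , λ a≡u → contradiction a≡u a≢u) ◅ ε
    ... | no x≢u   = off x≢u a≢u
    hub star with w , uw , w≢a , w≢b ← other = (adj⇒≢ (adj-sym uw) , uw , w≢a , w≢b) ◅ off (adj⇒≢ (adj-sym uw)) a≢u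

-- Edges and degrees in the line graph of a simple graph.

module _ {X : SimpleGraph n} where

  infix 4 _∈ₑ_
  _∈ₑ_ : Fin n → LEdge X → Set
  x ∈ₑ e = x ≡ proj₁ (proj₁ e) ⊎ x ≡ proj₂ (proj₁ e)

  LEdge-≡ : {e f : LEdge X} → proj₁ e ≡ proj₁ f → e ≡ f
  LEdge-≡ {_ , lt , a} {_ , lt′ , a′} refl
    rewrite ℕ.≤-irrelevant lt lt′ | ≡-irrelevant a a′ = refl

  -- The order on the endpoints gives each edge a single orientation, which excludes the reversed
  -- matches.
  ends-≡ : ∀ {e f : LEdge X} {x y} → x ∈ₑ e → y ∈ₑ e → x ≢ y → x ∈ₑ f → y ∈ₑ f → e ≡ f
  ends-≡ (inj₁ refl) (inj₁ refl) x≢y _ _ = contradiction refl x≢y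
  ends-≡ (inj₂ refl) (inj₂ refl) x≢y _ _ = contradiction refl x≢y
  ends-≡ _ _ x≢y (inj₁ refl) (inj₁ refl) = contradiction refl x≢y
  ends-≡ _ _ x≢y (inj₂ refl) (inj₂ refl) = contradiction refl x≢y
  ends-≡ {_ , lt , _} {_ , lt′ , _} (inj₁ refl) (inj₂ refl) _ (inj₂ refl) (inj₁ refl) = contradiction lt′ (ℕ.<⇒≯ lt)
  ends-≡ {_ , lt , _} {_ , lt′ , _} (inj₂ refl) (inj₁ refl) _ (inj₁ refl) (inj₂ refl) = contradiction lt′ (ℕ.<⇒≯ lt)
  ends-≡ (inj₁ refl) (inj₂ refl) _ (inj₁ refl) (inj₂ refl) = LEdge-≡ refl
  ends-≡ (inj₂ refl) (inj₁ refl) _ (inj₂ refl) (inj₁ refl) = LEdge-≡ refl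

  shareEnd⇒common : ∀ {e f : LEdge X} → ShareEnd {X = X} e f → ∃ λ x → x ∈ₑ e × x ∈ₑ f
  shareEnd⇒common (inj₁ eq)               = _ , inj₁ refl , inj₁ eq
  shareEnd⇒common (inj₂ (inj₁ eq))        = _ , inj₁ refl , inj₂ eq
  shareEnd⇒common (inj₂ (inj₂ (inj₁ eq))) = _ , inj₂ refl , inj₁ eq
  shareEnd⇒common (inj₂ (inj₂ (inj₂ eq))) = _ , inj₂ refl , inj₂ eq

  common⇒shareEnd : ∀ {e f : LEdge X} {x} → x ∈ₑ e → x ∈ₑ f → ShareEnd {X = X} e f
  common⇒shareEnd (inj₁ refl) (inj₁ eq) = inj₁ eq
  common⇒shareEnd (inj₁ refl) (inj₂ eq) = inj₂ (inj₁ eq)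
  common⇒shareEnd (inj₂ refl) (inj₁ eq) = inj₂ (inj₂ (inj₁ eq))
  common⇒shareEnd (inj₂ refl) (inj₂ eq) = inj₂ (inj₂ (inj₂ eq))

  LineGraph-sym : Symmetric (Adj (LineGraph X))
  LineGraph-sym {e} {f} (e≢f , share) =
    let x , x∈e , x∈f = shareEnd⇒common {e} {f} share
    in e≢f ∘ ≡.sym , common⇒shareEnd {f} {e} x∈f x∈e

  join : ∀ {x y} → adj X x y ≡ true → LEdge X
  join {x} {y} xy with Fin.<-cmp x y
  ... | tri< lt _ _ = (x , y) , lt , xy
  ... | tri≈ _ eq _ = contradiction eq (adj⇒≢ X xy)
  ... | tri> _ _ gt = (y , x) , gt , adj-sym X xy

  ∈-joinˡ : ∀ {x y} (xy : adj X x y ≡ true) → x ∈ₑ join xy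
  ∈-joinˡ {x} {y} xy with Fin.<-cmp x y
  ... | tri< _ _ _  = inj₁ refl
  ... | tri≈ _ eq _ = contradiction eq (adj⇒≢ X xy)
  ... | tri> _ _ _  = inj₂ refl

  ∈-joinʳ : ∀ {x y} (xy : adj X x y ≡ true) → y ∈ₑ join xy
  ∈-joinʳ {x} {y} xy with Fin.<-cmp x y
  ... | tri< _ _ _  = inj₂ refl
  ... | tri≈ _ eq _ = contradiction eq (adj⇒≢ X xy)
  ... | tri> _ _ _  = inj₁ refl

  ∈-join⁻ : ∀ {x y} (xy : adj X x y ≡ true) {z} → z ∈ₑ join xy → z ≡ x ⊎ z ≡ y
  ∈-join⁻ {x} {y} xy z∈ with Fin.<-cmp x y
  ∈-join⁻ xy z∈          | tri< _ _ _  = z∈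
  ∈-join⁻ xy z∈          | tri≈ _ eq _ = contradiction eq (adj⇒≢ X xy)
  ∈-join⁻ xy (inj₁ z≡y)  | tri> _ _ _  = inj₂ z≡y
  ∈-join⁻ xy (inj₂ z≡x)  | tri> _ _ _  = inj₁ z≡x

  other-end : ∀ {x} (e : LEdge X) → x ∈ₑ e → ∃ λ y → y ∈ₑ e × adj X x y ≡ true
  other-end (_ , _ , a) (inj₁ refl) = _ , inj₂ refl , a
  other-end (_ , _ , a) (inj₂ refl) = _ , inj₁ refl , adj-sym X a

  -- Each end of `e` lies on `d` further edges, and no edge is counted at both ends, since it would
  -- then be `e` itself.
  LineGraph-neighbourhood : Regular (toGraph X) (suc d) → ∀ e → Neighbourhood (LineGraph X) e (2 * d)
  LineGraph-neighbourhood {d} regular e@((a , b) , a<b , ab) = record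
    { nbr       = nbrₑ ∘ remQuot {2} d
    ; injective = λ i j eq → trans (≡.sym (Fin.combine-remQuot {2} d i))
        (trans (cong (uncurry combine) (nbrₑ-injective (remQuot {2} d i) (remQuot {2} d j) eq)) (Fin.combine-remQuot {2} d j))
    ; sound     = nbrₑ-sound ∘ remQuot {2} d
    ; complete  = λ {w} ew → let (s , j) , eq = nbrₑ-complete w ew in
        combine s j , trans (cong nbrₑ (Fin.remQuot-combine s j)) eq
    }
    where
    N : ∀ x → Neighbourhood (toGraph X) x (suc d)
    N x = list⇒Neighbourhood (regular x)
    end other : Fin 2 → Fin n
    end 0F = a
    end 1F = b
    other 0F = b
    other 1F = a
    end∈ : ∀ s → end s ∈ₑ e
    end∈ 0F = inj₁ refl
    end∈ 1F = inj₂ refl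
    other∈ : ∀ s → other s ∈ₑ e
    other∈ 0F = inj₂ refl
    other∈ 1F = inj₁ refl
    end-other : ∀ s → adj X (end s) (other s) ≡ true
    end-other 0F = ab
    end-other 1F = adj-sym X ab
    skip : ∀ s → ∃ λ i → nbr (N (end s)) i ≡ other s
    skip s = complete (N (end s)) (end-other s)
    -- `punchIn` leaves out the index at which `e` itself leads to its other end.
    far : Fin 2 → Fin d → Fin n
    far s j = nbr (N (end s)) (punchIn (proj₁ (skip s)) j)
    far-adj : ∀ s j → adj X (end s) (far s j) ≡ true
    far-adj s j = sound (N (end s)) _
    far≢other : ∀ s j → far s j ≢ other s
    far≢other s j eq = Fin.punchInᵢ≢i (proj₁ (skip s)) j
      (injective (N (end s)) _ _ (trans eq (≡.sym (proj₂ (skip s)))))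
    nbrₑ : Fin 2 × Fin d → LEdge X
    nbrₑ (s , j) = join (far-adj s j)
    e∌far : ∀ s j → ¬ (far s j ∈ₑ e)
    e∌far 0F j (inj₁ eq) = adj⇒≢ X (far-adj 0F j) (≡.sym eq)
    e∌far 0F j (inj₂ eq) = far≢other 0F j eq
    e∌far 1F j (inj₁ eq) = far≢other 1F j eq
    e∌far 1F j (inj₂ eq) = adj⇒≢ X (far-adj 1F j) (≡.sym eq)
    nbrₑ-sound : ∀ p → Adj (LineGraph X) e (nbrₑ p)
    nbrₑ-sound (s , j) =
      (λ eq → e∌far s j (subst (far s j ∈ₑ_) (≡.sym (LEdge-≡ {e} {nbrₑ (s , j)} eq)) (∈-joinʳ (far-adj s j)))) ,
      common⇒shareEnd {e} {nbrₑ (s , j)} (end∈ s) (∈-joinˡ (far-adj s j))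
    end-injective : ∀ s s′ → end s ≡ end s′ → s ≡ s′
    end-injective 0F 0F _  = refl
    end-injective 0F 1F eq = contradiction eq (adj⇒≢ X ab)
    end-injective 1F 0F eq = contradiction (≡.sym eq) (adj⇒≢ X ab)
    end-injective 1F 1F _  = refl
    nbrₑ-injective : ∀ p q → nbrₑ p ≡ nbrₑ q → p ≡ q
    nbrₑ-injective (s , j) (s′ , j′) eq
      with end-injective s s′ (end≡ (∈-join⁻ (far-adj s′ j′) (subst (end s ∈ₑ_) eq (∈-joinˡ (far-adj s j)))))
      where
      end≡ : end s ≡ end s′ ⊎ end s ≡ far s′ j′ → end s ≡ end s′
      end≡ (inj₁ eq) = eq
      end≡ (inj₂ eq) = contradiction (subst (_∈ₑ e) eq (end∈ s)) (e∌far s′ j′)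
    ... | refl with ∈-join⁻ (far-adj s j′) {far s j} (subst (far s j ∈ₑ_) eq (∈-joinʳ (far-adj s j)))
    ...   | inj₁ far≡end = contradiction (≡.sym far≡end) (adj⇒≢ X (far-adj s j))
    ...   | inj₂ far≡far = cong (s ,_) (Fin.punchIn-injective _ _ _ (injective (N (end s)) _ _ far≡far))
    which-end : ∀ {x} → x ∈ₑ e → ∃ λ s → x ≡ end s
    which-end (inj₁ eq) = 0F , eq
    which-end (inj₂ eq) = 1F , eq
    nbrₑ-complete : ∀ w → Adj (LineGraph X) e w → ∃ λ p → nbrₑ p ≡ w
    nbrₑ-complete w (e≢w , share)
      with x , x∈e , x∈w ← shareEnd⇒common {e} {w} share
      with s , refl ← which-end x∈e
      with y , y∈w , xy ← other-end w x∈w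
      with i , refl ← complete (N (end s)) xy =
      (s , punchOut skip≢i) ,
      ends-≡ {nbrₑ (s , punchOut skip≢i)} (∈-joinˡ far-adj′) (∈-joinʳ far-adj′) (adj⇒≢ X far-adj′) x∈w
        (subst (_∈ₑ w) (cong (nbr (N (end s))) (≡.sym (Fin.punchIn-punchOut skip≢i))) y∈w)
      where
      skip≢i : proj₁ (skip s) ≢ i
      -- At the skipped index `w` would contain both ends of `e`.
      skip≢i refl = e≢w (cong proj₁ (ends-≡ {e} {w} (end∈ s) (other∈ s) (adj⇒≢ X (end-other s)) x∈w
        (subst (_∈ₑ w) (proj₂ (skip s)) y∈w)))
      far-adj′ = far-adj s (punchOut skip≢i)

-- Regular graphs given by neighbour functions.

module FromNeighbours {k : ℕ} (nb : Fin n → Fin k → Fin n)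
  (nb-injective : ∀ u i j → nb u i ≡ nb u j → i ≡ j)
  (nb-sym : ∀ u i → ∃ λ j → nb (nb u i) j ≡ u)
  (nb-irrefl : ∀ u i → nb u i ≢ u) where

  adjacent? : ∀ u x → Dec (∃ λ i → nb u i ≡ x)
  adjacent? u x = any? (λ i → nb u i ≟ x)

  reverse-adjacent : ∀ {u x} → (∃ λ i → nb u i ≡ x) → ∃ λ i → nb x i ≡ u
  reverse-adjacent (i , refl) = nb-sym _ i

  graph : SimpleGraph n
  graph = record
    { adj   = λ u x → does (adjacent? u x)
    ; sym   = λ u x → does-⇔ (mk⇔ reverse-adjacent reverse-adjacent) (adjacent? u x) (adjacent? x u)
    ; irref = λ u → dec-false (adjacent? u u) (uncurry (nb-irrefl u))
    }

  adjacent⁺ : ∀ {u x} → (∃ λ i → nb u i ≡ x) → adj graph u x ≡ true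
  adjacent⁺ {u} {x} = dec-true (adjacent? u x)

  adjacent⁻ : ∀ {u x} → adj graph u x ≡ true → ∃ λ i → nb u i ≡ x
  adjacent⁻ {u} {x} ux with adjacent? u x
  ... | yes p = p

  regular : Regular (toGraph graph) k
  regular u = Neighbourhood⇒list {G = toGraph graph} record
    { nbr = nb u ; injective = nb-injective u ; sound = λ i → adjacent⁺ (i , refl) ; complete = adjacent⁻ }

-- The cyclic arrangement of nodes and blobs.

module Construction (n : ℕ) where

  k : ℕ
  k = 3 + n

  -- v i and w i are the nodes; b i l is the blob of the l-th edge at w i, whose other end v (node l i)
  -- is v i for l = 0, 1 and v (next i) otherwise; it is attached by its vertices 0 and 1.
  Vertex : Set
  Vertex = (Fin k ⊎ Fin k) ⊎ (Fin k × Fin k × Fin (suc k))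

  pattern v i = inj₁ (inj₁ i)
  pattern w i = inj₁ (inj₂ i)
  pattern b i l c = inj₂ (i , l , c)

  -- `unit l` inverts `node l`: the `l`-th blob at `v i` has index `(unit l i , l)`.
  node unit : Fin k → Fin k → Fin k
  node 0F i            = i
  node 1F i            = i
  node (suc (suc _)) i = next i
  unit 0F i            = i
  unit 1F i            = i
  unit (suc (suc _)) i = prev i

  node-unit : ∀ l i → node l (unit l i) ≡ i
  node-unit 0F i            = refl
  node-unit 1F i            = refl
  node-unit (suc (suc _)) i = next-prev i

  unit-node : ∀ l i → unit l (node l i) ≡ i
  unit-node 0F i            = refl
  unit-node 1F i            = refl
  unit-node (suc (suc _)) i = prev-next i

  -- The blob as a complete graph seen from position `c`. The missing edge between 0 and 1 frees one
  -- slot at each of them: at 0 it leads to `v (node l i)`, at 1 to `w i`. The diagonal is skipped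
  -- by `punchIn` in `nb`.
  port : (i l : Fin k) (c c′ : Fin (suc k)) → Vertex
  port i l 0F            1F            = v (node l i)
  port i l 1F            0F            = w i
  port i l 0F            0F            = b i l 0F
  port i l 0F            (suc (suc c)) = b i l (suc (suc c))
  port i l 1F            (suc c)       = b i l (suc c)
  port i l (suc (suc _)) c             = b i l c

  nb : Vertex → Fin k → Vertex
  nb (v i)     l = b (unit l i) l 0F
  nb (w i)     l = b i l 1F
  nb (b i l c) j = port i l c (punchIn c j)

  Link : Vertex → Vertex → Set
  Link x y = ∃ λ j → nb x j ≡ y

  port-injective : ∀ i l c {c′ c″} → port i l c c′ ≡ port i l c c″ → c′ ≡ c″
  port-injective i l 0F            {0F}          {0F}          _    = refl
  port-injective i l 0F            {1F}          {1F}          _    = refl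
  port-injective i l 0F            {suc (suc _)} {suc (suc _)} refl = refl
  port-injective i l 0F            {0F}          {1F}          ()
  port-injective i l 0F            {0F}          {suc (suc _)} ()
  port-injective i l 1F            {0F}          {0F}          _    = refl
  port-injective i l 1F            {suc _}       {suc _}       refl = refl
  port-injective i l (suc (suc _))                             refl = refl

  nb-injective : ∀ x i j → nb x i ≡ nb x j → i ≡ j
  nb-injective (v i)     l l′ refl = refl
  nb-injective (w i)     l l′ refl = refl
  nb-injective (b i l c) j j′ eq   = Fin.punchIn-injective c j j′ (port-injective i l c eq)

  data PortView (i l : Fin k) (c : Fin (suc k)) : Vertex → Set where
    inside : ∀ {c′} → PortView i l c (b i l c′)
    to-v   : c ≡ 0F → PortView i l c (v (node l i))
    to-w   : c ≡ 1F → PortView i l c (w i)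

  portView : ∀ i l c c′ → PortView i l c (port i l c c′)
  portView i l 0F            0F            = inside
  portView i l 0F            1F            = to-v refl
  portView i l 0F            (suc (suc _)) = inside
  portView i l 1F            0F            = to-w refl
  portView i l 1F            (suc _)       = inside
  portView i l (suc (suc _)) _             = inside

  link-port : ∀ i l {c c′} → c ≢ c′ → Link (b i l c) (port i l c c′)
  link-port i l {c} c≢c′ = punchOut c≢c′ , cong (port i l c) (Fin.punchIn-punchOut c≢c′)

  exit-v : ∀ i l → Link (b i l 0F) (v (node l i))
  exit-v i l = link-port i l {0F} {1F} λ ()

  exit-w : ∀ i l → Link (b i l 1F) (w i)
  exit-w i l = link-port i l {1F} {0F} λ ()

  v-link : ∀ l i → Link (v (node l i)) (b i l 0F)
  v-link l i = l , cong (λ i → b i l 0F) (unit-node l i)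

  link-sym : Symmetric Link
  link-sym {v i}     (l , refl) = subst (λ i′ → Link (b (unit l i) l 0F) (v i′)) (node-unit l i)
                                    (exit-v (unit l i) l)
  link-sym {w i}     (l , refl) = exit-w i l
  link-sym {b i l c} (j , refl) = back c (punchIn c j) (Fin.punchInᵢ≢i c j)
    where
    back : ∀ c c′ → c′ ≢ c → Link (port i l c c′) (b i l c)
    back 0F            0F            c′≢c = contradiction refl c′≢c
    back 0F            1F            _    = v-link l i
    back 0F            (suc (suc _)) c′≢c = link-port i l c′≢c
    back 1F            0F            _    = l , refl
    back 1F            1F            c′≢c = contradiction refl c′≢c
    back 1F            (suc (suc _)) c′≢c = link-port i l c′≢c
    back (suc (suc _)) 0F            c′≢c = link-port i l c′≢c
    back (suc (suc _)) 1F            c′≢c = link-port i l c′≢c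
    back (suc (suc _)) (suc (suc _)) c′≢c = link-port i l c′≢c

  nb-irrefl : ∀ x j → nb x j ≢ x
  nb-irrefl (v _)     j ()
  nb-irrefl (w _)     j ()
  nb-irrefl (b i l c) j = irrefl c (punchIn c j) (Fin.punchInᵢ≢i c j)
    where
    irrefl : ∀ c c′ → c′ ≢ c → port i l c c′ ≢ b i l c
    irrefl 0F            0F            c′≢c _    = c′≢c refl
    irrefl 0F            1F            _    ()
    irrefl 0F            (suc (suc _)) _    ()
    irrefl 1F            0F            _    ()
    irrefl 1F            1F            c′≢c _    = c′≢c refl
    irrefl 1F            (suc (suc _)) _    ()
    irrefl (suc (suc _)) _             c′≢c refl = c′≢c refl

  size : ℕ
  size = (k + k) + k * (k * suc k)

  Fin↔Vertex : Fin size ↔ Vertex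
  Fin↔Vertex = ↔-trans Fin.+↔⊎ (Fin.+↔⊎ ⊎-↔ ↔-trans Fin.*↔× (↔-refl ×-↔ Fin.*↔×))

  -- Only the two inverse laws of the numbering are used below; its arithmetic stays folded.
  abstract
    dec : Fin size → Vertex
    dec = Inverse.to Fin↔Vertex

    enc : Vertex → Fin size
    enc = Inverse.from Fin↔Vertex

    dec-enc : ∀ x → dec (enc x) ≡ x
    dec-enc = Inverse.strictlyInverseˡ Fin↔Vertex

    enc-dec : ∀ i → enc (dec i) ≡ i
    enc-dec = Inverse.strictlyInverseʳ Fin↔Vertex

  enc-injective : ∀ {x y} → enc x ≡ enc y → x ≡ y
  enc-injective {x} {y} eq = trans (≡.sym (dec-enc x)) (trans (cong dec eq) (dec-enc y))

  dec-injective : ∀ {x y} → dec x ≡ dec y → x ≡ y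
  dec-injective {x} {y} eq = trans (≡.sym (enc-dec x)) (trans (cong enc eq) (enc-dec y))

  _≟ᵥ_ : DecidableEquality Vertex
  _≟ᵥ_ = Sum.≡-dec (Sum.≡-dec _≟_ _≟_) (Product.≡-dec _≟_ (Product.≡-dec _≟_ _≟_))

  nbF : Fin size → Fin k → Fin size
  nbF u j = enc (nb (dec u) j)

  nbF-enc : ∀ x j → nbF (enc x) j ≡ enc (nb x j)
  nbF-enc x j = cong (λ x → enc (nb x j)) (dec-enc x)

  nbF-injective : ∀ u i j → nbF u i ≡ nbF u j → i ≡ j
  nbF-injective u i j eq = nb-injective (dec u) i j (enc-injective eq)

  nbF-sym : ∀ u i → ∃ λ j → nbF (nbF u i) j ≡ u
  nbF-sym u i = let j , eq = link-sym {dec u} (i , refl) in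
    j , trans (nbF-enc (nb (dec u) i) j) (trans (cong enc eq) (enc-dec u))

  nbF-irrefl : ∀ u i → nbF u i ≢ u
  nbF-irrefl u i eq = nb-irrefl (dec u) i (trans (≡.sym (dec-enc _)) (cong dec eq))

  open FromNeighbours nbF nbF-injective nbF-sym nbF-irrefl

  abstract
    X : SimpleGraph size
    X = graph

    X-regular : Regular (toGraph X) k
    X-regular = regular

    link⇒adj : ∀ {x y} → Link x y → adj X (enc x) (enc y) ≡ true
    link⇒adj {x} (j , refl) = adjacent⁺ {enc x} (j , nbF-enc x j)

    adj⇒link : ∀ {x y} → adj X x y ≡ true → Link (dec x) (dec y)
    adj⇒link {x} {y} xy = let j , eq = adjacent⁻ {x} {y} xy in j , trans (≡.sym (dec-enc _)) (cong dec eq)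

  -- Two-connectedness of the constructed graph.

  module Off (u : Vertex) where

    _~_ : Vertex → Vertex → Set
    _~_ = Star (λ x y → Link x y × x ≢ u × y ≢ u)

    ~-sym : Symmetric _~_
    ~-sym = reverse λ (xy , x≢u , y≢u) → link-sym xy , y≢u , x≢u

    step : ∀ {x y} → Link x y → x ≢ u → y ≢ u → x ~ y
    step xy x≢u y≢u = (xy , x≢u , y≢u) ◅ ε

    to-0F : ∀ i l c → (∀ c → b i l c ≢ u) → b i l c ~ b i l 0F
    to-0F i l 0F            free = ε
    -- 0 and 1 are not adjacent in the blob, so the path passes through 2.
    to-0F i l 1F            free = step (link-port i l {1F} {2F} λ ()) (free _) (free _)
                                ◅◅ step (link-port i l {2F} {0F} λ ()) (free _) (free _)
    to-0F i l (suc (suc c)) free = step (link-port i l {suc (suc c)} {0F} λ ()) (free _) (free _)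

    crossing : ∀ i l → (∀ c → b i l c ≢ u) → v (node l i) ≢ u → w i ≢ u → v (node l i) ~ w i
    crossing i l free v≢u w≢u = step (v-link l i) v≢u (free _)
      ◅◅ ~-sym (to-0F i l 1F free) ◅◅ step (exit-w i l) (free _) w≢u

    around : (f : Fin k → Vertex) (m : Fin k) → (∀ i → i ≢ m → f (prev i) ~ f i) → ∀ i j → f i ~ f j
    around f = cycle-minus-link-connected {R = λ i j → f i ~ f j} (record { refl = ε ; sym = ~-sym ; trans = _◅◅_ })

    -- The walk from `v (prev i)` to `v i` passes `w (prev i)`; trouble at unit `m` therefore costs
    -- the link that enters `v (next m)`.
    around-v : (m : Fin k) → (∀ i → i ≢ m → v i ~ w i) → (∀ i → i ≢ m → v (next i) ~ w i) → ∀ i j → v i ~ v j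
    around-v m vw vw′ = around (λ i → v i) (next m) λ i i≢ →
      let p≢m = λ p≡m → i≢ (trans (≡.sym (next-prev i)) (cong next p≡m)) in
      vw (prev i) p≢m ◅◅ ~-sym (subst (λ i′ → v i′ ~ w (prev i)) (next-prev i) (vw′ (prev i) p≢m))

  -- Deleting `u` breaks the closed walk through the remaining nodes in at most one place.
  nodes-connected : ∀ u → ∃ λ h → ∀ x → inj₁ x ≢ u → Off._~_ u (inj₁ x) h
  nodes-connected (v m) = w m , λ where
      (inj₁ i) v≢u → vw i (v≢u ∘ cong (λ i → v i)) ◅◅ ww i m
      (inj₂ i) _   → ww i m
    where
    open Off (v m)
    vw : ∀ i → i ≢ m → v i ~ w i
    vw i i≢m = crossing i 0F (λ _ ()) (λ { refl → i≢m refl }) λ ()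
    ww : ∀ i j → w i ~ w j
    ww = around (λ i → w i) m λ i i≢m →
      ~-sym (crossing (prev i) 2F (λ _ ()) (λ { eq → i≢m (trans (≡.sym (next-prev i)) (v-inj eq)) }) λ ())
        ◅◅ subst (λ i′ → v i′ ~ w i) (≡.sym (next-prev i)) (vw i i≢m)
      where
      v-inj : ∀ {i j} → _≡_ {A = Vertex} (v i) (v j) → i ≡ j
      v-inj refl = refl
  nodes-connected (w m) = v m , λ where
      (inj₁ i) _   → vv i m
      (inj₂ i) w≢u → ~-sym (vw i (w≢u ∘ cong (λ i → w i))) ◅◅ vv i m
    where
    open Off (w m)
    vw : ∀ i → i ≢ m → v i ~ w i
    vw i i≢m = crossing i 0F (λ _ ()) (λ ()) λ { refl → i≢m refl }
    vv : ∀ i j → v i ~ v j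
    vv = around-v m vw λ i i≢m → crossing i 2F (λ _ ()) (λ ()) λ { refl → i≢m refl }
  nodes-connected u@(b m l c) = v m , λ where
      (inj₁ i) _ → vv i m
      (inj₂ i) _ → ~-sym (vw l i) ◅◅ vv i m
    where
    open Off u
    -- Of the two parallel blobs between `v i` and `w i`, the one not numbered like the damaged blob
    -- is used.
    vw : ∀ l′ {c} i → Off._~_ (b m l′ c) (v i) (w i)
    vw 0F       {c} i = Off.crossing (b m 0F c) i 1F (λ _ ()) (λ ()) λ ()
    vw (suc l′) {c} i = Off.crossing (b m (suc l′) c) i 0F (λ _ ()) (λ ()) λ ()
    vv : ∀ i j → v i ~ v j
    -- For `k = 3` a single blob joins `w m` to `v (next m)` and may be the damaged one, so this
    -- link is given up.
    vv = around-v m (λ i _ → vw l i) λ i i≢m → crossing i 2F (λ _ → λ { refl → i≢m refl }) (λ ()) λ ()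

  -- A blob has two exits, and one deleted vertex cannot block both.
  blob-exit : ∀ u i l c → b i l c ≢ u → ∃ λ x → inj₁ x ≢ u × Off._~_ u (b i l c) (inj₁ x)
  blob-exit u@(inj₁ _) i l c _ = go (w i ≟ᵥ u)
    where
    open Off u
    go : Dec (w i ≡ u) → ∃ λ x → inj₁ x ≢ u × b i l c ~ inj₁ x
    go (yes refl) = _ , (λ ()) , to-0F i l c (λ _ ()) ◅◅ step (exit-v i l) (λ ()) λ ()
    go (no w≢u)   = _ , w≢u , to-0F i l c (λ _ ()) ◅◅ ~-sym (to-0F i l 1F (λ _ ()))
                              ◅◅ step (exit-w i l) (λ ()) w≢u
  blob-exit u@(b _ _ _) i l 0F ≢u = _ , (λ ()) , Off.step u (exit-v i l) ≢u λ ()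
  blob-exit u@(b _ _ _) i l 1F ≢u = _ , (λ ()) , Off.step u (exit-w i l) ≢u λ ()
  blob-exit u@(b _ _ _) i l c@(suc (suc _)) ≢u = go (b i l 0F ≟ᵥ u)
    where
    open Off u
    go : Dec (b i l 0F ≡ u) → ∃ λ x → inj₁ x ≢ u × b i l c ~ inj₁ x
    go (yes refl) = _ , (λ ()) , step (link-port i l {c} {1F} λ ()) ≢u (λ ())
                                 ◅◅ step (exit-w i l) (λ ()) λ ()
    go (no 0≢u)   = _ , (λ ()) , step (link-port i l {c} {0F} λ ()) ≢u 0≢u
                                 ◅◅ step (exit-v i l) 0≢u λ ()

  X-twoConnected : TwoConnected X
  X-twoConnected u x y x≢u y≢u =
    subst₂ (Star (AdjOff X u)) (enc-dec x) (enc-dec y)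
      (gmap enc (λ (xy , x≢ , y≢) → link⇒adj xy , enc≢ x≢ , enc≢ y≢) (to-hub (dec x) (x≢u ∘ dec-injective)
        ◅◅ ~-sym (to-hub (dec y) (y≢u ∘ dec-injective))))
    where
    open Off (dec u)
    enc≢ : ∀ {x} → x ≢ dec u → enc x ≢ u
    enc≢ x≢ eq = x≢ (trans (≡.sym (dec-enc _)) (cong dec eq))
    h = proj₁ (nodes-connected (dec u))
    to-hub : ∀ x → x ≢ dec u → x ~ h
    to-hub (inj₁ x)  x≢u = proj₂ (nodes-connected (dec u)) x x≢u
    to-hub (b i l c) x≢u = let x , x≢u , path = blob-exit (dec u) i l c x≢u in
      path ◅◅ proj₂ (nodes-connected (dec u)) x x≢u

  -- Edges of the constructed graph and the blobs they meet.

  L : Graph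
  L = LineGraph X

  -- A record rather than a definition, so that x and e can be inferred.
  infix 4 _∈_
  record _∈_ (x : Vertex) (e : LEdge X) : Set where
    constructor mk
    field un : _∈ₑ_ {X = X} (enc x) e
  open _∈_

  edge-≡ : ∀ {e f x y} → x ∈ e → y ∈ e → x ≢ y → x ∈ f → y ∈ f → e ≡ f
  edge-≡ {e} {f} {x} {y} x∈e y∈e x≢y x∈f y∈f =
    ends-≡ {X = X} {e} {f} (un x∈e) (un y∈e) (x≢y ∘ enc-injective {x} {y}) (un x∈f) (un y∈f)

  ⟨_⟩ : ∀ {x y} → Link x y → LEdge X
  ⟨_⟩ {x} {y} xy = join {X = X} {enc x} {enc y} (link⇒adj {x} {y} xy)

  ∈ˡ : ∀ {x y} (xy : Link x y) → x ∈ ⟨_⟩ {x} {y} xy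
  ∈ˡ {x} {y} xy = mk (∈-joinˡ {X = X} {enc x} {enc y} (link⇒adj {x} {y} xy))

  ∈ʳ : ∀ {x y} (xy : Link x y) → y ∈ ⟨_⟩ {x} {y} xy
  ∈ʳ {x} {y} xy = mk (∈-joinʳ {X = X} {enc x} {enc y} (link⇒adj {x} {y} xy))

  other-endpoint : ∀ {x e} → x ∈ e → ∃ λ j → nb x j ∈ e
  other-endpoint {x} {e} x∈e =
    let y , y∈e , xy = other-end {X = X} e (un x∈e)
        j , eq      = adj⇒link {enc x} {y} xy
        y≡nb        = trans (≡.sym (enc-dec y)) (trans (cong enc (≡.sym eq)) (nbF-enc x j))
    in j , mk (subst (λ y → _∈ₑ_ {X = X} y e) y≡nb y∈e)

  common-endpoint : ∀ {e f} → Adj L e f → ∃ λ x → x ∈ e × x ∈ f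
  common-endpoint {e} {f} (_ , share) =
    let t , t∈e , t∈f = shareEnd⇒common {X = X} {e} {f} share in
    dec t , mk (subst (λ y → _∈ₑ_ {X = X} y e) (≡.sym (enc-dec t)) t∈e) ,
            mk (subst (λ y → _∈ₑ_ {X = X} y f) (≡.sym (enc-dec t)) t∈f)

  cycle-adj : (H : HamiltonCycle L) → ∀ {e f} → CycleEdge H e f → Adj L e f
  cycle-adj H (i , inj₁ (refl , refl)) = adj H i
  cycle-adj H (i , inj₂ (refl , refl)) = LineGraph-sym {X = X} {c H i} {c H (next i)} (adj H i)

  -- The last clause is junk: no edge joins two nodes.
  label′ : Vertex → Vertex → Fin k × Fin k
  label′ (b i l _) _         = i , l
  label′ (inj₁ _)  (b i l _) = i , l
  label′ (inj₁ _)  (inj₁ _)  = 0F , 0F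

  -- Every edge of X meets exactly one blob.
  label : LEdge X → Fin k × Fin k
  label ((x , y) , _) = label′ (dec x) (dec y)

  label-link : ∀ {x i l c} → Link x (b i l c) → label′ x (b i l c) ≡ (i , l)
  label-link {v _} _ = refl
  label-link {w _} _ = refl
  label-link {b i l c} (j , eq) with port i l c (punchIn c j) | portView i l c (punchIn c j)
  label-link {b i l c} (j , refl) | _ | inside = refl

  label-∈ : ∀ {e i l c} → b i l c ∈ e → label e ≡ (i , l)
  label-∈ {(_ , y) , _} {i} {l} {c} (mk (inj₁ refl)) = cong (λ x → label′ x (dec y)) (dec-enc (b i l c))
  label-∈ {(x , _) , _ , xy} {i} {l} {c} (mk (inj₂ refl)) =
    trans (cong (label′ (dec x)) (dec-enc (b i l c)))
          (label-link (subst (Link (dec x)) (dec-enc (b i l c)) (adj⇒link xy)))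

  abstract
    -- The two edges of the cut that separates the blob `(i , l)` from the rest.
    wEdge vEdge : (i l : Fin k) → LEdge X
    wEdge i l = ⟨_⟩ {b i l 1F} {w i} (exit-w i l)
    vEdge i l = ⟨_⟩ {b i l 0F} {v (node l i)} (exit-v i l)

    w∈wEdge : ∀ i l → w i ∈ wEdge i l
    w∈wEdge i l = ∈ʳ {b i l 1F} {w i} (exit-w i l)

    b∈wEdge : ∀ i l → b i l 1F ∈ wEdge i l
    b∈wEdge i l = ∈ˡ {b i l 1F} {w i} (exit-w i l)

    v∈vEdge : ∀ i l → v (node l i) ∈ vEdge i l
    v∈vEdge i l = ∈ʳ {b i l 0F} {v (node l i)} (exit-v i l)

    b∈vEdge : ∀ i l → b i l 0F ∈ vEdge i l
    b∈vEdge i l = ∈ˡ {b i l 0F} {v (node l i)} (exit-v i l)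

  label-wEdge : ∀ i l → label (wEdge i l) ≡ (i , l)
  label-wEdge i l = label-∈ (b∈wEdge i l)

  wEdge-injective : ∀ {i l l′} → wEdge i l ≡ wEdge i l′ → l ≡ l′
  wEdge-injective {i} {l} {l′} eq =
    cong proj₂ (trans (≡.sym (label-wEdge i l)) (trans (cong label eq) (label-wEdge i l′)))

  w∈⇒wEdge : ∀ {i e} → w i ∈ e → ∃ λ l → e ≡ wEdge i l
  w∈⇒wEdge {i} w∈e = let l , b∈e = other-endpoint w∈e in
    l , edge-≡ w∈e b∈e (λ ()) (w∈wEdge i l) (b∈wEdge i l)

  wEdge-adj : ∀ i {l l′} → l ≢ l′ → Adj L (wEdge i l) (wEdge i l′)
  wEdge-adj i {l} {l′} l≢l′ =
    (λ eq → l≢l′ (wEdge-injective (LEdge-≡ {X = X} {wEdge i l} {wEdge i l′} eq))) ,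
    common⇒shareEnd {X = X} {wEdge i l} {wEdge i l′} (un (w∈wEdge i l)) (un (w∈wEdge i l′))

  -- Edges inside a blob.

  InBlob : (i l : Fin k) → Vertex → Set
  InBlob i l x = ∃ λ c → x ≡ b i l c

  InBlob? : ∀ i l x → Dec (InBlob i l x)
  InBlob? i l x = any? λ c → x ≟ᵥ b i l c

  Inside : (i l : Fin k) → LEdge X → Set
  Inside i l ((x , y) , _) = InBlob i l (dec x) × InBlob i l (dec y)

  Inside? : ∀ i l e → Dec (Inside i l e)
  Inside? i l ((x , y) , _) = InBlob? i l (dec x) ×-dec InBlob? i l (dec y)

  Inside⁻ : ∀ {i l x} e → Inside i l e → x ∈ e → InBlob i l x
  Inside⁻ {i} {l} _ (p , _) (mk (inj₁ refl)) = subst (InBlob i l) (dec-enc _) p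
  Inside⁻ {i} {l} _ (_ , q) (mk (inj₂ refl)) = subst (InBlob i l) (dec-enc _) q

  Inside⁺ : ∀ {i l c c′} e → b i l c ∈ e → b i l c′ ∈ e → c ≢ c′ → Inside i l e
  Inside⁺ _ (mk (inj₁ refl)) (mk (inj₂ refl)) _ = (_ , dec-enc _) , (_ , dec-enc _)
  Inside⁺ _ (mk (inj₂ refl)) (mk (inj₁ refl)) _ = (_ , dec-enc _) , (_ , dec-enc _)
  Inside⁺ _ (mk (inj₁ refl)) (mk (inj₁ eq)) c≢c′ with refl ← enc-injective eq = contradiction refl c≢c′
  Inside⁺ _ (mk (inj₂ refl)) (mk (inj₂ eq)) c≢c′ with refl ← enc-injective eq = contradiction refl c≢c′

  -- Only the vertices 0 and 1 of a blob have a neighbour outside it, and each has just one.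
  blob-edge : ∀ {i l c} e → b i l c ∈ e → Inside i l e ⊎ e ≡ wEdge i l ⊎ e ≡ vEdge i l
  blob-edge {i} {l} {c} e b∈e with other-endpoint b∈e
  ... | j , y∈e with port i l c (punchIn c j) | portView i l c (punchIn c j) | nb-irrefl (b i l c) j
  ...   | _ | inside    | y≢b = inj₁ (Inside⁺ e b∈e y∈e λ { refl → y≢b refl })
  ...   | _ | to-w refl | _   = inj₂ (inj₁ (edge-≡ b∈e y∈e (λ ()) (b∈wEdge i l) (w∈wEdge i l)))
  ...   | _ | to-v refl | _   = inj₂ (inj₂ (edge-≡ b∈e y∈e (λ ()) (b∈vEdge i l) (v∈vEdge i l)))

  -- Hamilton cycles of the line graph at blobs and nodes.

  module _ (H : HamiltonCycle L) where

    -- The blob hangs on the rest of X by a 2-edge cut, so a Hamilton cycle of L(X) passes through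
    -- wEdge i l from the outside of the blob to its inside.
    enters-blob : ∀ i l → ∃ λ e → CycleEdge H (wEdge i l) e × Inside i l e
    enters-blob i l with j , eq ← surj H (wEdge i l)
      with Inside? i l (c H (next j)) | Inside? i l (c H (prev j))
    ... | yes p | _     = c H (next j) , subst (λ e → CycleEdge H e (c H (next j))) eq (next-edge H j) , p
    ... | no _  | yes p = c H (prev j) , subst (λ e → CycleEdge H e (c H (prev j))) eq (prev-edge H j) , p
    ... | no ¬p | no ¬q = contradiction (Inside⁻ {x = w i} (wEdge i l) w-inside (w∈wEdge i l)) λ ()
      where
      none : ∀ e → CycleEdge H (wEdge i l) e → ¬ Inside i l e
      none e e∈H with cycle-neighbours H j (subst (λ x → CycleEdge H x e) (≡.sym eq) e∈H)
      ... | inj₁ refl = ¬p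
      ... | inj₂ refl = ¬q
      core : LEdge X
      core = ⟨_⟩ {b i l 0F} {b i l 2F} (link-port i l {0F} {2F} λ ())
      core-inside : Inside i l core
      core-inside = Inside⁺ core (∈ˡ {b i l 0F} {b i l 2F} (link-port i l {0F} {2F} λ ()))
                                  (∈ʳ {b i l 0F} {b i l 2F} (link-port i l {0F} {2F} λ ())) λ ()
      ¬vEdge-inside : ¬ Inside i l (vEdge i l)
      ¬vEdge-inside p with () ← Inside⁻ {x = v (node l i)} (vEdge i l) p (v∈vEdge i l)
      wEdge≢vEdge : wEdge i l ≢ vEdge i l
      wEdge≢vEdge eq = ¬vEdge-inside (Inside⁺ (vEdge i l) (b∈vEdge i l) (subst (b i l 1F ∈_) eq (b∈wEdge i l)) λ ())
      link : ∀ e f → CycleEdge H e f → e ≢ vEdge i l → f ≢ vEdge i l → Inside i l e → Inside i l f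
      link e f ef e≢ f≢ pe with x , x∈e , x∈f ← common-endpoint {e} {f} (cycle-adj H ef)
        with d , refl ← Inside⁻ e pe x∈e
        with blob-edge f x∈f
      ... | inj₁ pf          = pf
      ... | inj₂ (inj₂ eq)   = contradiction eq f≢
      ... | inj₂ (inj₁ refl) = contradiction pe (none e (CycleEdge-sym H ef))
      -- With no inside neighbour at `wEdge i l`, the cycle minus `vEdge i l` could not leave the
      -- inside. Followed from `core`, it would put `wEdge i l` inside too, although `w i` is an end
      -- of it.
      w-inside : Inside i l (wEdge i l)
      w-inside = closed-off-vertex H (Inside? i l) (vEdge i l) link core (wEdge i l)
        (λ eq → ¬vEdge-inside (subst (Inside i l) eq core-inside)) wEdge≢vEdge core-inside

    -- One of the two `H`-neighbours of `wEdge i l` lies inside its blob, so at most one is an edge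
    -- at `w i`.
    no-crossing : ∀ i {l l′ m} → CycleEdge H (wEdge i l) (wEdge i l′) → m ≢ l′ →
                  ¬ CycleEdge H (wEdge i l) (wEdge i m)
    no-crossing i {l} {l′} {m} ll′ m≢l′ lm with e , le , pe ← enters-blob i l
      with at-most-two H ll′ le (λ { refl → outside l′ pe }) lm
      where
      outside : ∀ m → ¬ Inside i l (wEdge i m)
      outside m p with () ← Inside⁻ {x = w i} (wEdge i m) p (w∈wEdge i m)
    ... | inj₁ eq   = m≢l′ (wEdge-injective eq)
    ... | inj₂ refl with () ← Inside⁻ {x = w i} (wEdge i m) pe (w∈wEdge i m)

    -- arc marks the blobs strictly between w i and w j; in the cyclic order v m is followed by the
    -- blobs (m , 0) and (m , 1), then w m, then the remaining blobs (m , l), then v (next m).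
    module Arc {i j : Fin k} (i<j : i F.< j)
      (turn-i : CycleEdge H (wEdge i 0F) (wEdge i 1F)) (turn-j : CycleEdge H (wEdge j 0F) (wEdge j 1F)) where

      -- The blobs before `w m` lie on the arc when `i < m ≤ j`, those after it when `i ≤ m < j`.
      low high : Fin k → Bool
      low m  = does (toℕ i <? toℕ m) ∧ does (toℕ m <? suc (toℕ j))
      high m = does (toℕ i <? suc (toℕ m)) ∧ does (toℕ m <? toℕ j)

      arc : Fin k × Fin k → Bool
      arc (m , 0F)          = low m
      arc (m , 1F)          = low m
      arc (m , suc (suc _)) = high m

      low≡high : ∀ {m} → m ≢ i → m ≢ j → low m ≡ high m
      low≡high {m} m≢i m≢j = cong₂ _∧_
        (does-⇔ (mk⇔ ℕ.m≤n⇒m≤1+n (λ i<1+m → ℕ.≤∧≢⇒< (ℕ.≤-pred i<1+m) (m≢i ∘ ≡.sym ∘ Fin.toℕ-injective)))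
               (toℕ i <? toℕ m) (toℕ i <? suc (toℕ m)))
        (does-⇔ (mk⇔ (λ m<1+j → ℕ.≤∧≢⇒< (ℕ.≤-pred m<1+j) (m≢j ∘ Fin.toℕ-injective)) ℕ.m≤n⇒m≤1+n)
               (toℕ m <? suc (toℕ j)) (toℕ m <? toℕ j))

      high-prev : ∀ m → high (prev m) ≡ low m
      -- The arc does not wrap around: `j` is at most the last index, so `high` is false there, as
      -- `low` is at zero.
      high-prev zero = trans (cong (λ t → does (toℕ i <? suc t) ∧ does (t <? toℕ j)) (Fin.toℕ-fromℕ _))
        (trans (cong (does (toℕ i <? k) ∧_) (dec-false (2 + n <? toℕ j) (ℕ.≤⇒≯ (ℕ.≤-pred (Fin.toℕ<n j)))))
               (∧-zeroʳ (does (toℕ i <? k))))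
      high-prev (suc m) = cong (λ t → does (toℕ i <? suc t) ∧ does (t <? toℕ j)) (Fin.toℕ-inject₁ m)

      arc-unit : ∀ l m → arc (unit l m , l) ≡ low m
      arc-unit 0F            m = refl
      arc-unit 1F            m = refl
      arc-unit (suc (suc _)) m = high-prev m

      -- The turn uses up the contacts of edges 0 and 1 at `w m`, so `H` joins neither of them to an
      -- edge on the other side.
      turn-closed : ∀ m → CycleEdge H (wEdge m 0F) (wEdge m 1F) →
                    ∀ l l′ → CycleEdge H (wEdge m l) (wEdge m l′) → arc (m , l) ≡ arc (m , l′)
      turn-closed m t 0F            0F            _ = refl
      turn-closed m t 0F            1F            _ = refl
      turn-closed m t 0F            (suc (suc _)) e = contradiction e (no-crossing m t λ ())
      turn-closed m t 1F            0F            _ = refl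
      turn-closed m t 1F            1F            _ = refl
      turn-closed m t 1F            (suc (suc _)) e = contradiction e (no-crossing m (CycleEdge-sym H t) λ ())
      turn-closed m t (suc (suc _)) 0F            e = contradiction (CycleEdge-sym H e) (no-crossing m t λ ())
      turn-closed m t (suc (suc _)) 1F            e =
        contradiction (CycleEdge-sym H e) (no-crossing m (CycleEdge-sym H t) λ ())
      turn-closed m t (suc (suc _)) (suc (suc _)) _ = refl

      arc-low : ∀ {m} → m ≢ i → m ≢ j → ∀ l → arc (m , l) ≡ low m
      arc-low m≢i m≢j 0F            = refl
      arc-low m≢i m≢j 1F            = refl
      arc-low m≢i m≢j (suc (suc _)) = ≡.sym (low≡high m≢i m≢j)

      w-closed : ∀ m l l′ → CycleEdge H (wEdge m l) (wEdge m l′) → arc (m , l) ≡ arc (m , l′)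
      w-closed m l l′ e with m ≟ i | m ≟ j
      ... | yes refl | _        = turn-closed m turn-i l l′ e
      ... | no _     | yes refl = turn-closed m turn-j l l′ e
      ... | no m≢i   | no m≢j   = trans (arc-low m≢i m≢j l) (≡.sym (arc-low m≢i m≢j l′))

      -- Edges meeting in a blob carry the same label, all edges at a `v m` lie on the same side of
      -- the arc, and at a `w m` the value could change only at `w i` and `w j`, where `H` turns
      -- back.
      arc-closed : ∀ e f → CycleEdge H e f → arc (label e) ≡ arc (label f)
      arc-closed e f ef with common-endpoint {e} {f} (cycle-adj H ef)
      ... | b _ _ _ , x∈e , x∈f = cong arc (trans (label-∈ x∈e) (≡.sym (label-∈ x∈f)))
      ... | v m     , x∈e , x∈f = trans (at-v x∈e) (≡.sym (at-v x∈f))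
        where
        at-v : ∀ {e} → v m ∈ e → arc (label e) ≡ low m
        at-v v∈e = let l , b∈e = other-endpoint v∈e in trans (cong arc (label-∈ b∈e)) (arc-unit l m)
      ... | w m     , x∈e , x∈f with l , refl ← w∈⇒wEdge x∈e | l′ , refl ← w∈⇒wEdge x∈f =
        trans (cong arc (label-wEdge m l)) (trans (w-closed m l l′ ef) (cong arc (≡.sym (label-wEdge m l′))))

      -- At the arc's end `w i`, edge 0 lies outside and edge 2 on the arc, yet `H` visits both.
      absurd : ⊥
      absurd = contradiction (trans (≡.sym outer)
        (trans (closed⇒constant H (arc ∘ label) arc-closed (wEdge i 0F) (wEdge i 2F)) inner)) λ ()
        where
        outer : arc (label (wEdge i 0F)) ≡ false
        outer = trans (cong arc (label-wEdge i 0F))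
          (cong (_∧ does (toℕ i <? suc (toℕ j))) (dec-false (toℕ i <? toℕ i) (ℕ.<-irrefl refl)))
        inner : arc (label (wEdge i 2F)) ≡ true
        inner = trans (cong arc (label-wEdge i 2F))
          (cong₂ _∧_ (dec-true (toℕ i <? suc (toℕ i)) (ℕ.n<1+n _)) (dec-true (toℕ i <? toℕ j) i<j))

  -- Counting cycles against turns.

  no-HamiltonDecomposition : ¬ HamiltonDecomposition L
  no-HamiltonDecomposition (m , regular , H , disjoint) = go regular
    where
    N : ∀ e → Neighbourhood L e (2 * (2 + n))
    N = LineGraph-neighbourhood {X = X} X-regular
    e₀ = wEdge 0F 0F
    go : Regular L (2 * m) ⊎ Regular L (suc (2 * m)) → ⊥
    -- The line graph has even degree `2 * (k - 1)`, read off at the edge `e₀`.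
    go (inj₂ R) = ℕ.even≢odd (2 + n) m (degree-unique (N e₀) (list⇒Neighbourhood (R e₀)))
    go (inj₁ R) = let i , j , i<j , hi≡hj = Fin.pigeonhole m<k (proj₁ ∘ turn)
      in Arc.absurd (H (proj₁ (turn i))) i<j (proj₂ (turn i))
           (subst (λ h → CycleEdge (H h) (wEdge j 0F) (wEdge j 1F)) (≡.sym hi≡hj) (proj₂ (turn j)))
      where
      m<k : m < k
      -- Comparing degrees at `e₀` gives `m ≤ 2 + n`, one less than `k`.
      m<k = s≤s (ℕ.*-cancelˡ-≤ 2 (degree-≤ (list⇒Neighbourhood (R e₀)) (N e₀)))
      turn : ∀ i → ∃ λ h → CycleEdge (H h) (wEdge i 0F) (wEdge i 1F)
      turn i = cycles-cover (λ {e} {f} → LineGraph-sym {X = X} {e} {f}) H disjoint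
                 (list⇒Neighbourhood (R (wEdge i 0F))) (wEdge-adj i λ ())

theorem1 : ∀ (k : ℕ) → 3 ≤ k →
    Σ ℕ λ n → Σ (SimpleGraph n) λ X →
    Connected (toGraph X) × Regular (toGraph X) k ×
    NoSeparatingTransitions X × ¬ HamiltonDecomposition (LineGraph X)
theorem1 (suc (suc (suc n))) (s≤s (s≤s (s≤s z≤n))) =
  size , X , (enc (w 0F) , twoConnected⇒reachable X X-regular X-twoConnected) , X-regular ,
  twoConnected⇒noSeparating X X-regular X-twoConnected , no-HamiltonDecomposition
  where open Construction n
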